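{- For $1\le i\le k$ let $G_i$ be an $r_i$-regular graph with $n_i$ vertices, let $r=r_1\cdots r_k$, and suppose $\gcd(n_i, r/r_i)=1$ for every $i$. If each $G_i$ is $\mathbb{Z}_{n_i}$-distance antimagic, then the direct product $G_1\times\cdots\times G_k$ is $\mathbb{Z}_{n_1\cdots n_k}$-distance antimagic.
   Context: The direct product $G_1\times\cdots\times G_k$ has vertex set $V(G_1)\times\cdots\times V(G_k)$, with $(x_1,\ldots,x_k)$ and $(y_1,\ldots,y_k)$ adjacent iff $x_iy_i\in E(G_i)$ for every $i$. For a graph $G$ with $n$ vertices, a $\mathbb{Z}_n$-distance antimagic labelling is a bijection $f:V(G)\to\mathbb{Z}_n$ such that the weights $w_f(x)=\sum_{y\in N(x)} f(y)$ (mod $n$, $N(x)$ the open neighbourhood) are pairwise distinct; $G$ is $\mathbb{Z}_n$-distance antimagic if such a labelling exists. -}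

module Defs where

open import Data.Fin using (Fin; zero; suc; toℕ)
open import Data.Fin.Properties using (all?; *↔×; nonZeroIndex)
open import Data.List using (List; []; _∷_; allFin; filter; length; map; sum)
open import Data.Nat using (ℕ; zero; suc; _*_; NonZero)
open import Data.Nat.DivMod using (_/_; _mod_; m*n/n≡m)
open import Data.Nat.Properties using (*-comm; *-assoc)
open import Data.Product using (_×_; _,_; proj₁; proj₂; ∃-syntax)
open import Data.Product.Function.NonDependent.Propositional using (_×-↔_)
open import Data.Unit using (⊤; tt)
open import Data.Vec.Functional as Vector using (Vector; removeAt)
open import Function using (_∘_; _↔_; mk↔ₛ′; Inverse; Injective; Bijective)
open import Function.Construct.Composition using (_↔-∘_)
open import Relation.Binary using (Rel; Symmetric; Irreflexive; Decidable)
open import Relation.Binary.PropositionalEquality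
open import Level using (0ℓ)

-- Finite simple graphs.  `enum` exhibits V as a set with `order` elements; the
-- order in which it lists them affects neither degrees nor weights below.
record Graph : Set₁ where
  field
    V       : Set
    order   : ℕ
    enum    : Fin order ↔ V
    Adj     : Rel V 0ℓ
    adj?    : Decidable Adj
    symm    : Symmetric Adj
    irrefl  : Irreflexive _≡_ Adj

  vertices : List V
  vertices = map (Inverse.to enum) (allFin order)

  N : V → List V
  N x = filter (adj? x) vertices

  degree : V → ℕ
  degree x = length (N x)

open Graph public using (V; order)

Regular : ℕ → Graph → Set
Regular r G = ∀ x → Graph.degree G x ≡ r

-- ℤ_n is represented by Fin n: the sum of the labels is taken in ℕ and then
-- reduced mod n.  The label of x witnesses that n is nonzero.
weight : (G : Graph) {n : ℕ} → (V G → Fin n) → V G → Fin n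
weight G {n} f x =
  _mod_ (sum (map (toℕ ∘ f) (Graph.N G x))) n {{nonZeroIndex (f x)}}

ℤ[_]-DistanceAntimagic : ℕ → Graph → Set
ℤ[ n ]-DistanceAntimagic G =
  ∃[ f ] Bijective {A = V G} {B = Fin n} _≡_ _≡_ f × Injective _≡_ _≡_ (weight G f)

∏ : ∀ {k} → Vector ℕ k → ℕ
∏ = Vector.foldr _*_ 1

-- The product of all entries except the i-th.  For r i ≠ 0 this is the quotient
-- ∏ r / r i, as shown by ∏/ below; it is also meaningful when r i = 0.
∏-except : ∀ {k} → Fin (suc k) → Vector ℕ (suc k) → ℕ
∏-except i r = ∏ (removeAt r i)

∏-except-* : ∀ {k} (i : Fin (suc k)) (r : Vector ℕ (suc k)) → ∏ r ≡ ∏-except i r * r i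
∏-except-* zero r = *-comm (r zero) _
∏-except-* {suc k} (suc i) r =
  trans (cong (r zero *_) (∏-except-* i (r ∘ suc)))
        (sym (*-assoc (r zero) (∏-except i (r ∘ suc)) (r (suc i))))

∏/ : ∀ {k} (i : Fin (suc k)) (r : Vector ℕ (suc k)) .{{_ : NonZero (r i)}} →
     ∏ r / r i ≡ ∏-except i r
∏/ i r = trans (cong (_/ r i) (∏-except-* i r)) (m*n/n≡m (∏-except i r) (r i))

-- The cartesian product A 0 × ⋯ × A (k - 1).  Nested pairs are used rather than
-- dependent functions so that _≡_ is componentwise equality without function
-- extensionality.
Tuple : ∀ {k} → (Fin k → Set) → Set
Tuple {zero}  A = ⊤
Tuple {suc k} A = A zero × Tuple (A ∘ suc)

component : ∀ {k} (A : Fin k → Set) → Tuple A → (i : Fin k) → A i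
component A x zero    = proj₁ x
component A x (suc i) = component (A ∘ suc) (proj₂ x) i

enumTuple : ∀ {k} (A : Fin k → Set) (n : Vector ℕ k) →
            (∀ i → Fin (n i) ↔ A i) → Fin (∏ n) ↔ Tuple A
enumTuple {zero}  A n e =
  mk↔ₛ′ (λ _ → tt) (λ _ → zero) (λ _ → refl) (λ { zero → refl })
enumTuple {suc k} A n e =
  (e zero ×-↔ enumTuple (A ∘ suc) (n ∘ suc) (e ∘ suc)) ↔-∘ *↔×

-- At least one factor is required: the empty product would be a single vertex
-- with a loop.
directProduct : ∀ {k} → (Fin (suc k) → Graph) → Graph
directProduct G = record
  { V      = Tuple (V ∘ G)
  ; order  = ∏ (order ∘ G)
  ; enum   = enumTuple (V ∘ G) (order ∘ G) (λ i → Graph.enum (G i))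
  ; Adj    = λ x y → ∀ i → Graph.Adj (G i) (x ! i) (y ! i)
  ; adj?   = λ x y → all? (λ i → Graph.adj? (G i) (x ! i) (y ! i))
  ; symm   = λ xy i → Graph.symm (G i) (xy i)
  ; irrefl = λ { refl xx → Graph.irrefl (G zero) refl (xx zero) }
  }
  where _!_ = component (V ∘ G)

{-# OPTIONS --safe #-}
-- Label a pair (x , y) in mixed radix by m · f x + g y.  If the factors are r-
-- and s-regular, the weight of (x , y) is m · s · w(x) + r · w(y).  Modulo m
-- this is r · w(y), which determines w(y) mod m, hence y, as gcd(m, r) = 1;
-- cancelling r · w(y) and m leaves s · w(x) mod n, which determines x as
-- gcd(n, s) = 1.  Iterate over the factors.
module Submission where

open import Defs
open import Data.Fin using (Fin; zero; suc; toℕ; remQuot; punchOut; _↑ˡ_; _↑ʳ_)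
open import Data.Fin.Properties
  using (*↔×; ∀-cons; toℕ-combine; toℕ-fromℕ<; nonZeroIndex; all?; 0≢1+n; suc-injective; toℕ-injective;
         splitAt-↑ˡ; splitAt-↑ʳ)
open import Data.List
  using (List; []; _∷_; _++_; allFin; cartesianProduct; filter; length; map; tabulate)
open import Data.List.Properties
  using (filter-++; filter-reject; filter-≐; length-++; length-map; map-++;
         map-∘; map-cong; map-tabulate; tabulate-cong)
open import Data.Nat using (ℕ; zero; suc; _+_; _*_; _∸_; _≤_; NonZero; ∣_-_∣)
open import Data.Nat.Coprimality
  using (Coprime; coprime-divisor; gcd≡1⇒coprime) renaming (sym to coprime-sym)
open import Data.Nat.Divisibility
open import Data.Nat.DivMod
open import Data.Nat.GCD using (gcd)
open import Data.Nat.ListAction using (sum)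
open import Data.Nat.ListAction.Properties using (sum-++)
open import Data.Nat.Properties hiding (0≢1+n; suc-injective)
open import Data.Nat.Tactic.RingSolver using (solve-∀)
open import Data.Product using (_×_; _,_; proj₁; proj₂; <_,_>; uncurry)
import Data.Product as Product
open import Data.Product.Function.NonDependent.Propositional using (_×-↔_)
open import Data.Sum using ([_,_]′)
open import Data.Unit using (tt)
open import Data.Vec.Functional using (Vector; removeAt)
open import Data.Vec.Functional.Properties using (removeAt-punchOut)
open import Function using (_∘_; id; _↔_; mk↔ₛ′; mk⤖; Bijection; Inverse)
open import Function.Construct.Composition using (_↔-∘_)
open import Function.Properties.Bijection using (⤖⇒↔)
open import Function.Properties.Inverse using (↔-sym; ↔⇒⤖)
open import Relation.Binary using (Rel) renaming (Decidable to Decidable₂)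
open import Relation.Binary.PropositionalEquality
open import Relation.Nullary using (yes; no; contradiction)
open import Relation.Unary using (Pred; Decidable)
open import Relation.Unary.Properties using (_×?_)
open import Level using (0ℓ)

private variable
  A B C D : Set

-- Congruence and coprimality

-- Equal remainders cancel from the two division-algorithm expansions, leaving a difference of
-- multiples of `n`. The absolute difference keeps congruences in ℕ, where coprime factors can be
-- cancelled by divisibility.
%≡%⇒∣∣-∣ : ∀ a b n .{{_ : NonZero n}} → a % n ≡ b % n → n ∣ ∣ a - b ∣
%≡%⇒∣∣-∣ a b n eq = divides ∣ a / n - b / n ∣ (begin
  ∣ a - b ∣
    ≡⟨ cong₂ ∣_-_∣ (m≡m%n+[m/n]*n a n) (m≡m%n+[m/n]*n b n) ⟩
  ∣ a % n + a / n * n - b % n + b / n * n ∣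
    ≡⟨ cong (λ c → ∣ c + a / n * n - b % n + b / n * n ∣) eq ⟩
  ∣ b % n + a / n * n - b % n + b / n * n ∣
    ≡⟨ ∣m+n-m+o∣≡∣n-o∣ (b % n) _ _ ⟩
  ∣ a / n * n - b / n * n ∣
    ≡⟨ *-distribʳ-∣-∣ n (a / n) (b / n) ⟨
  ∣ a / n - b / n ∣ * n ∎)
  where open ≡-Reasoning

∣∣-∣⇒%≡% : ∀ a b n .{{_ : NonZero n}} → n ∣ ∣ a - b ∣ → a % n ≡ b % n
∣∣-∣⇒%≡% a b n n∣ = [ ordered n∣ , (λ b≤a → sym (ordered (subst (n ∣_) (∣-∣-comm a b) n∣) b≤a)) ]′ (≤-total a b)
  where
  open ≡-Reasoning
  ordered : ∀ {a b} → n ∣ ∣ a - b ∣ → a ≤ b → a % n ≡ b % n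
  ordered {a} {b} n∣ a≤b = begin
    a % n             ≡⟨ %-remove-+ʳ a (subst (n ∣_) (m≤n⇒∣m-n∣≡n∸m a≤b) n∣) ⟨
    (a + (b ∸ a)) % n ≡⟨ cong (_% n) (m+[n∸m]≡n a≤b) ⟩
    b % n             ∎

-- A common divisor of `m` and `n * o` is coprime to `n`, because it divides `m`; by Euclid's lemma
-- it therefore divides `o`.
coprime-* : ∀ {m n o} → Coprime m n → Coprime m o → Coprime m (n * o)
coprime-* mn mo (d∣m , d∣no) =
  mo (d∣m , coprime-divisor (λ (e∣d , e∣n) → mn (∣-trans e∣d d∣m , e∣n)) d∣no)

coprime-∏ : ∀ {k m} (n : Vector ℕ k) → (∀ i → Coprime m (n i)) → Coprime m (∏ n)
coprime-∏ {zero}  n c = ∣1⇒≡1 ∘ proj₂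
coprime-∏ {suc k} n c = coprime-* (c zero) (coprime-∏ (n ∘ suc) (c ∘ suc))

∣∏ : ∀ {k} (n : Vector ℕ k) i → n i ∣ ∏ n
∣∏ n zero    = m∣m*n _
∣∏ n (suc i) = ∣n⇒∣m*n (n zero) (∣∏ (n ∘ suc) i)

-- Serves to extract pairwise coprimality from the gcd hypothesis: `r j` survives the removal of
-- entry `i`, at position `punchOut i≢j`.
∣∏-except : ∀ {k} (r : Vector ℕ (suc k)) {i j} → i ≢ j → r j ∣ ∏-except i r
∣∏-except r {i} i≢j =
  subst (_∣ ∏-except i r) (removeAt-punchOut r i≢j) (∣∏ (removeAt r i) (punchOut i≢j))

-- Cartesian products of lists

length-cartesianProduct : (xs : List A) (ys : List B) →
  length (cartesianProduct xs ys) ≡ length xs * length ys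
length-cartesianProduct []       ys = refl
length-cartesianProduct (x ∷ xs) ys =
  trans (length-++ (map (x ,_) ys))
        (cong₂ _+_ (length-map (x ,_) ys) (length-cartesianProduct xs ys))

map-cartesianProduct : (f : A → C) (g : B → D) (xs : List A) (ys : List B) →
  map (Product.map f g) (cartesianProduct xs ys) ≡ cartesianProduct (map f xs) (map g ys)
map-cartesianProduct f g []       ys = refl
map-cartesianProduct f g (x ∷ xs) ys =
  trans (map-++ _ (map (x ,_) ys) _)
        (cong₂ _++_ (trans (sym (map-∘ ys)) (map-∘ ys)) (map-cartesianProduct f g xs ys))

module _ {P : Pred A 0ℓ} {Q : Pred B 0ℓ} (P? : Decidable P) (Q? : Decidable Q) where

  filter-row : ∀ {x} → P x → ∀ ys → filter (P? ×? Q?) (map (x ,_) ys) ≡ map (x ,_) (filter Q? ys)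
  filter-row px []       = refl
  filter-row {x} px (y ∷ ys) with ih ← filter-row px ys | P? x | Q? y
  ... | yes _  | yes _ = cong (_ ∷_) ih
  ... | yes _  | no _  = ih
  ... | no ¬px | _     = contradiction px ¬px

  -- Works row by row: the row of `x` is filtered by `Q?` alone if `P x` holds and vanishes
  -- otherwise. This makes neighbourhoods in a direct product into products of neighbourhoods.
  filter-cartesianProduct : ∀ xs ys →
    filter (P? ×? Q?) (cartesianProduct xs ys) ≡ cartesianProduct (filter P? xs) (filter Q? ys)
  filter-cartesianProduct []       ys = refl
  filter-cartesianProduct (x ∷ xs) ys with ih ← filter-cartesianProduct xs ys | P? x
  ... | yes px = trans (filter-++ (P? ×? Q?) (map (x ,_) ys) _) (cong₂ _++_ (filter-row px ys) ih)
  ... | no ¬px = trans (filter-++ (P? ×? Q?) (map (x ,_) ys) _) (cong₂ _++_ (row-empty ys) ih)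
    where
    row-empty : ∀ ys → filter (P? ×? Q?) (map (x ,_) ys) ≡ []
    row-empty []       = refl
    row-empty (y ∷ ys) = trans (filter-reject (P? ×? Q?) (¬px ∘ proj₁)) (row-empty ys)

tabulate-+ : ∀ m {n} (f : Fin (m + n) → A) →
  tabulate f ≡ tabulate (f ∘ (_↑ˡ n)) ++ tabulate (f ∘ (m ↑ʳ_))
tabulate-+ zero    f = refl
tabulate-+ (suc m) f = cong (f zero ∷_) (tabulate-+ m (f ∘ suc))

-- Of the `n + m * n` indices, the first `n` decode to row zero, and the rest decode to the rows of
-- the smaller grid shifted by `suc`.
remQuot-allFin : ∀ m n → map (remQuot {m} n) (allFin (m * n)) ≡ cartesianProduct (allFin m) (allFin n)
remQuot-allFin zero    n = refl
remQuot-allFin (suc m) n = begin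
  map rq (tabulate id)
    ≡⟨ map-tabulate id rq ⟩
  tabulate rq
    ≡⟨ tabulate-+ n rq ⟩
  tabulate (rq ∘ (_↑ˡ m * n)) ++ tabulate (rq ∘ (n ↑ʳ_))
    ≡⟨ cong₂ _++_ (tabulate-cong first) (tabulate-cong later) ⟩
  tabulate (zero ,_) ++ tabulate (Product.map suc id ∘ remQuot {m} n)
    ≡⟨ cong₂ _++_ (map-tabulate {n = n} id (zero ,_)) (map-tabulate {n = m * n} id (Product.map suc id ∘ remQuot {m} n)) ⟨
  map (zero ,_) (allFin n) ++ map (Product.map suc id ∘ remQuot {m} n) (allFin (m * n))
    ≡⟨ cong (map (zero ,_) (allFin n) ++_) (map-∘ (allFin (m * n))) ⟩
  map (zero ,_) (allFin n) ++ map (Product.map suc id) (map (remQuot {m} n) (allFin (m * n)))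
    ≡⟨ cong (λ l → map (zero ,_) (allFin n) ++ map (Product.map suc id) l) (remQuot-allFin m n) ⟩
  map (zero ,_) (allFin n) ++ map (Product.map suc id) (cartesianProduct (allFin m) (allFin n))
    ≡⟨ cong (map (zero ,_) (allFin n) ++_) (map-cartesianProduct suc id (allFin m) (allFin n)) ⟩
  map (zero ,_) (allFin n) ++ cartesianProduct (map suc (allFin m)) (map id (allFin n))
    ≡⟨ cong (map (zero ,_) (allFin n) ++_) (cong₂ cartesianProduct (map-tabulate id suc) (map-tabulate id id)) ⟩
  cartesianProduct (allFin (suc m)) (allFin n) ∎
  where
  open ≡-Reasoning
  rq = remQuot {suc m} n
  first : ∀ j → rq (j ↑ˡ m * n) ≡ (zero , j)
  first j rewrite splitAt-↑ˡ n j (m * n) = refl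
  later : ∀ j → rq (n ↑ʳ j) ≡ Product.map suc id (remQuot {m} n j)
  later j rewrite splitAt-↑ʳ n (m * n) j = refl

-- Each `a x` is met once per element of `ys` and each `b y` once per element of `xs`; for neighbour
-- lists these multiplicities are the degrees.
sum-cartesianProduct : ∀ m (a : A → ℕ) (b : B → ℕ) xs ys →
  sum (map (λ (x , y) → m * a x + b y) (cartesianProduct xs ys))
    ≡ m * (length ys * sum (map a xs)) + length xs * sum (map b ys)
sum-cartesianProduct m a b []       ys = sym (trans (+-identityʳ _)
  (trans (cong (m *_) (*-zeroʳ (length ys))) (*-zeroʳ m)))
sum-cartesianProduct m a b (x ∷ xs) ys = begin
  sum (map h (map (x ,_) ys ++ cartesianProduct xs ys))
    ≡⟨ cong sum (map-++ h (map (x ,_) ys) _) ⟩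
  sum (map h (map (x ,_) ys) ++ map h (cartesianProduct xs ys))
    ≡⟨ sum-++ (map h (map (x ,_) ys)) _ ⟩
  sum (map h (map (x ,_) ys)) + sum (map h (cartesianProduct xs ys))
    ≡⟨ cong₂ _+_ (trans (cong sum (sym (map-∘ ys))) (row ys)) (sum-cartesianProduct m a b xs ys) ⟩
  length ys * (m * a x) + sum (map b ys)
    + (m * (length ys * sum (map a xs)) + length xs * sum (map b ys))
    ≡⟨ regroup m (length ys) (a x) (sum (map b ys)) (sum (map a xs)) (length xs) ⟩
  m * (length ys * sum (map a (x ∷ xs))) + length (x ∷ xs) * sum (map b ys) ∎
  where
  open ≡-Reasoning
  h = λ (x , y) → m * a x + b y
  row : ∀ ys → sum (map (h ∘ (x ,_)) ys) ≡ length ys * (m * a x) + sum (map b ys)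
  row []       = refl
  row (y ∷ ys) = trans (cong (m * a x + b y +_) (row ys)) (swap (m * a x) (b y) _ _)
    where
    swap : ∀ p q u v → p + q + (u + v) ≡ p + u + (q + v)
    swap = solve-∀
  regroup : ∀ m l p u q k → l * (m * p) + u + (m * (l * q) + k * u) ≡ m * (l * (p + q)) + (u + k * u)
  regroup = solve-∀

-- Antimagic labellings for arbitrary neighbour lists, so that the empty
-- product, a single vertex with a loop, can serve as the base case.

labelSum : ∀ {n} → (A → List A) → (A → Fin n) → A → ℕ
labelSum nb f x = sum (map (toℕ ∘ f) (nb x))

-- Distinctness modulo `n` is phrased by divisibility, so no proof that `n` is nonzero has to be
-- carried along.
record Antimagic (nb : A → List A) (n : ℕ) : Set where
  field
    label    : A ↔ Fin n
    distinct : ∀ x y → n ∣ ∣ labelSum nb (Inverse.to label) x - labelSum nb (Inverse.to label) y ∣ → x ≡ y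

_⊗_ : (A → List A) → (B → List B) → A × B → List (A × B)
(nb ⊗ nb′) (x , y) = cartesianProduct (nb x) (nb′ y)

-- Labelling a product of two factors

module _ {nb : A → List A} {nb′ : B → List B} {n m r s : ℕ}
         (reg : ∀ x → length (nb x) ≡ r) (reg′ : ∀ y → length (nb′ y) ≡ s)
         (n⊥s : Coprime n s) (m⊥r : Coprime m r)
         (am : Antimagic nb n) (am′ : Antimagic nb′ m) where

  open Antimagic am renaming (label to φ; distinct to φ-distinct)
  open Antimagic am′ renaming (label to ψ; distinct to ψ-distinct)

  private
    f = Inverse.to φ
    g = Inverse.to ψ
    w = labelSum nb f
    w′ = labelSum nb′ g

    φψ : (A × B) ↔ Fin (n * m)
    -- The inverse of `*↔×` is `combine`, which sends a pair `(i , j)` to `m * i + j`.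
    φψ = ↔-sym *↔× ↔-∘ (φ ×-↔ ψ)

    W = labelSum (nb ⊗ nb′) (Inverse.to φψ)

    W-split : ∀ x y → W (x , y) ≡ m * (s * w x) + r * w′ y
    W-split x y = begin
      W (x , y)
        ≡⟨ cong sum (map-cong (λ (u , v) → toℕ-combine (f u) (g v)) ((nb ⊗ nb′) (x , y))) ⟩
      sum (map (λ (u , v) → m * toℕ (f u) + toℕ (g v)) ((nb ⊗ nb′) (x , y)))
        ≡⟨ sum-cartesianProduct m (toℕ ∘ f) (toℕ ∘ g) (nb x) (nb′ y) ⟩
      m * (length (nb′ y) * w x) + length (nb x) * w′ y
        ≡⟨ cong₂ (λ l k → m * (l * w x) + k * w′ y) (reg′ y) (reg x) ⟩
      m * (s * w x) + r * w′ y ∎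
      where open ≡-Reasoning

    φψ-distinct : ∀ p q → n * m ∣ ∣ W p - W q ∣ → p ≡ q
    φψ-distinct (x , y) (x′ , y′) nm∣ = conclude y≡y′
      where
      open ≡-Reasoning
      instance
        m≢0 : NonZero m
        m≢0 = nonZeroIndex (g y)

      nm∣split : n * m ∣ ∣ m * (s * w x) + r * w′ y - m * (s * w x′) + r * w′ y′ ∣
      nm∣split = subst₂ (λ a b → n * m ∣ ∣ a - b ∣) (W-split x y) (W-split x′ y′) nm∣

      -- Passing from modulus `n * m` to `m` removes the contribution of the first factor.
      r*w′≡ : (r * w′ y) % m ≡ (r * w′ y′) % m
      r*w′≡ = begin
        (r * w′ y) % m
          ≡⟨ %-remove-+ˡ (r * w′ y) (m∣m*n (s * w x)) ⟨
        (m * (s * w x) + r * w′ y) % m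
          ≡⟨ ∣∣-∣⇒%≡% _ _ m (∣-trans (n∣m*n n) nm∣split) ⟩
        (m * (s * w x′) + r * w′ y′) % m
          ≡⟨ %-remove-+ˡ (r * w′ y′) (m∣m*n (s * w x′)) ⟩
        (r * w′ y′) % m ∎

      y≡y′ : y ≡ y′
      y≡y′ = ψ-distinct y y′ (coprime-divisor m⊥r
        (subst (m ∣_) (sym (*-distribˡ-∣-∣ r (w′ y) (w′ y′))) (%≡%⇒∣∣-∣ _ _ m r*w′≡)))

      conclude : y ≡ y′ → (x , y) ≡ (x′ , y′)
      -- Once `y′` is `y`, the terms `r * w′ y` cancel exactly in ℕ. Dividing by the nonzero `m`
      -- lowers the modulus to `n`, and `n⊥s` then removes `s`.
      conclude refl = cong (_, y) (φ-distinct x x′ (coprime-divisor n⊥s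
        (*-cancelˡ-∣ m (subst₂ _∣_ (*-comm n m) factored nm∣split))))
        where
        factored : ∣ m * (s * w x) + r * w′ y - m * (s * w x′) + r * w′ y ∣ ≡ m * (s * ∣ w x - w x′ ∣)
        factored = begin
          ∣ m * (s * w x) + r * w′ y - m * (s * w x′) + r * w′ y ∣
            ≡⟨ cong₂ ∣_-_∣ (+-comm _ (r * w′ y)) (+-comm _ (r * w′ y)) ⟩
          ∣ r * w′ y + m * (s * w x) - r * w′ y + m * (s * w x′) ∣
            ≡⟨ ∣m+n-m+o∣≡∣n-o∣ (r * w′ y) _ _ ⟩
          ∣ m * (s * w x) - m * (s * w x′) ∣
            ≡⟨ *-distribˡ-∣-∣ m _ _ ⟨
          m * ∣ s * w x - s * w x′ ∣
            ≡⟨ cong (m *_) (*-distribˡ-∣-∣ s _ _) ⟨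
          m * (s * ∣ w x - w x′ ∣) ∎

  ⊗-antimagic : Antimagic (nb ⊗ nb′) (n * m)
  ⊗-antimagic = record { label = φψ ; distinct = φψ-distinct }

-- Direct products of graphs

mod-≡⇒%-≡ : ∀ a b n .{{_ : NonZero n}} → a mod n ≡ b mod n → a % n ≡ b % n
mod-≡⇒%-≡ a b n eq =
  trans (sym (toℕ-fromℕ< (m%n<n a n))) (trans (cong toℕ eq) (toℕ-fromℕ< (m%n<n b n)))

%-≡⇒mod-≡ : ∀ a b n .{{_ : NonZero n}} → a % n ≡ b % n → a mod n ≡ b mod n
%-≡⇒mod-≡ a b n eq = toℕ-injective
  (trans (toℕ-fromℕ< (m%n<n a n)) (trans eq (sym (toℕ-fromℕ< (m%n<n b n)))))

DistanceAntimagic⇒Antimagic : ∀ (G : Graph) {n} → ℤ[ n ]-DistanceAntimagic G → Antimagic (Graph.N G) n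
DistanceAntimagic⇒Antimagic G {n} (f , bij , inj) = record
  { label    = ⤖⇒↔ (mk⤖ bij)
  ; distinct = λ x y n∣ →
      let instance n≢0 = nonZeroIndex (f x) in
      inj (%-≡⇒mod-≡ _ _ n (∣∣-∣⇒%≡% (labelSum (Graph.N G) f x) (labelSum (Graph.N G) f y) n n∣))
  }

Antimagic⇒DistanceAntimagic : ∀ (G : Graph) {n} → Antimagic (Graph.N G) n → ℤ[ n ]-DistanceAntimagic G
Antimagic⇒DistanceAntimagic G {n} am =
  f , Bijection.bijective (↔⇒⤖ label) , λ {x} {y} eq →
    let instance n≢0 = nonZeroIndex (f x) in
    distinct x y (%≡%⇒∣∣-∣ (labelSum (Graph.N G) f x) (labelSum (Graph.N G) f y) n (mod-≡⇒%-≡ _ _ n eq))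
  where
  open Antimagic am
  f = Inverse.to label

-- Transfers a labelling from the recursive neighbour lists to the filtered ones of the graph.
antimagic-cong : ∀ {nb nb′ : A → List A} {n} → nb ≗ nb′ → Antimagic nb n → Antimagic nb′ n
antimagic-cong nb≗nb′ am = record
  { label    = label
  ; distinct = λ x y → distinct x y ∘ subst₂ (λ xs ys → _ ∣ ∣ labels xs - labels ys ∣) (sym (nb≗nb′ x)) (sym (nb≗nb′ y))
  }
  where
  open Antimagic am
  labels : List _ → ℕ
  labels xs = sum (map (toℕ ∘ Inverse.to label) xs)

-- Neighbourhoods in the direct product as iterated products

tupleN : ∀ {k} (G : Fin k → Graph) → Tuple (V ∘ G) → List (Tuple (V ∘ G))
-- The empty tuple is vacuously adjacent to itself, so its degree is 1, the empty product.
tupleN {zero}  G = λ _ → tt ∷ []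
tupleN {suc k} G = Graph.N (G zero) ⊗ tupleN (G ∘ suc)

-- With `tupleAdj?` and `tuples`, this extends the data of `directProduct` to `k = 0`, where the
-- induction starts; for positive `k` they agree by definition.
TupleAdj : ∀ {k} (G : Fin k → Graph) → Rel (Tuple (V ∘ G)) 0ℓ
TupleAdj G x y = ∀ i → Graph.Adj (G i) (component (V ∘ G) x i) (component (V ∘ G) y i)

tupleAdj? : ∀ {k} (G : Fin k → Graph) → Decidable₂ (TupleAdj G)
tupleAdj? G x y = all? (λ i → Graph.adj? (G i) (component (V ∘ G) x i) (component (V ∘ G) y i))

tuples : ∀ {k} (G : Fin k → Graph) → List (Tuple (V ∘ G))
tuples G = map (Inverse.to (enumTuple (V ∘ G) (order ∘ G) (λ i → Graph.enum (G i)))) (allFin (∏ (order ∘ G)))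

tuples-suc : ∀ {k} (G : Fin (suc k) → Graph) →
  tuples G ≡ cartesianProduct (Graph.vertices (G zero)) (tuples (G ∘ suc))
tuples-suc G =
  trans (map-∘ (allFin (n * m)))
 (trans (cong (map (Product.map e es)) (remQuot-allFin n m))
        (map-cartesianProduct e es (allFin n) (allFin m)))
  where
  n = order (G zero)
  m = ∏ (order ∘ G ∘ suc)
  e = Inverse.to (Graph.enum (G zero))
  es = Inverse.to (enumTuple (V ∘ G ∘ suc) (order ∘ G ∘ suc) (λ i → Graph.enum (G (suc i))))

tupleN≗filter : ∀ {k} (G : Fin k → Graph) → tupleN G ≗ λ x → filter (tupleAdj? G x) (tuples G)
tupleN≗filter {zero}  G x        = refl
tupleN≗filter {suc k} G (x , xs) = begin
  cartesianProduct (Graph.N (G zero) x) (tupleN (G ∘ suc) xs)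
    ≡⟨ cong (cartesianProduct (Graph.N (G zero) x)) (tupleN≗filter (G ∘ suc) xs) ⟩
  cartesianProduct (Graph.N (G zero) x) (filter (tupleAdj? (G ∘ suc) xs) (tuples (G ∘ suc)))
    ≡⟨ filter-cartesianProduct (Graph.adj? (G zero) x) (tupleAdj? (G ∘ suc) xs)
         (Graph.vertices (G zero)) (tuples (G ∘ suc)) ⟨
  filter split? (cartesianProduct (Graph.vertices (G zero)) (tuples (G ∘ suc)))
    -- Adjacency of tuples is a quantifier over `Fin (suc k)`; it splits into its value at `zero`
    -- and its restriction to the tail.
    ≡⟨ filter-≐ split? (tupleAdj? G (x , xs)) (uncurry ∀-cons , < (λ a → a zero) , (λ a → a ∘ suc) >)
         (cartesianProduct (Graph.vertices (G zero)) (tuples (G ∘ suc))) ⟩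
  filter (tupleAdj? G (x , xs)) (cartesianProduct (Graph.vertices (G zero)) (tuples (G ∘ suc)))
    ≡⟨ cong (filter (tupleAdj? G (x , xs))) (tuples-suc G) ⟨
  filter (tupleAdj? G (x , xs)) (tuples G) ∎
  where
  open ≡-Reasoning
  split? = Graph.adj? (G zero) x ×? tupleAdj? (G ∘ suc) xs

tupleN-regular : ∀ {k} (G : Fin k → Graph) (r : Vector ℕ k) →
  (∀ i → Regular (r i) (G i)) → ∀ x → length (tupleN G x) ≡ ∏ r
tupleN-regular {zero}  G r reg x        = refl
tupleN-regular {suc k} G r reg (x , xs) =
  trans (length-cartesianProduct (Graph.N (G zero) x) _)
        (cong₂ _*_ (reg zero x) (tupleN-regular (G ∘ suc) (r ∘ suc) (reg ∘ suc) xs))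

-- Coprimality is assumed pairwise because that form restricts directly to the tail of the tuple.
tupleN-antimagic : ∀ {k} (G : Fin k → Graph) (n r : Vector ℕ k) →
  (∀ i → Regular (r i) (G i)) →
  (∀ i j → i ≢ j → Coprime (n i) (r j)) →
  (∀ i → ℤ[ n i ]-DistanceAntimagic (G i)) →
  Antimagic (tupleN G) (∏ n)
tupleN-antimagic {zero}  G n r reg n⊥r am = record
  { label    = mk↔ₛ′ (λ _ → zero) (λ _ → tt) (λ { zero → refl }) (λ _ → refl)
  ; distinct = λ _ _ _ → refl
  }
tupleN-antimagic {suc k} G n r reg n⊥r am =
  ⊗-antimagic (reg zero) (tupleN-regular (G ∘ suc) (r ∘ suc) (reg ∘ suc))
    -- The tail has degree `∏ (r ∘ suc)` and modulus `∏ (n ∘ suc)`: the first must be coprime to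
    -- `n zero`, the second to `r zero`.
    (coprime-∏ (r ∘ suc) (λ j → n⊥r zero (suc j) 0≢1+n))
    (coprime-sym (coprime-∏ (n ∘ suc) (λ i → coprime-sym (n⊥r (suc i) zero (0≢1+n ∘ sym)))))
    (DistanceAntimagic⇒Antimagic (G zero) (am zero))
    (tupleN-antimagic (G ∘ suc) (n ∘ suc) (r ∘ suc) (reg ∘ suc)
      (λ i j i≢j → n⊥r (suc i) (suc j) (i≢j ∘ suc-injective)) (am ∘ suc))

mainTheorem14 : ∀ {k} (G : Fin (suc k) → Graph) (n r : Fin (suc k) → ℕ) →
    (∀ i → order (G i) ≡ n i) →
    (∀ i → Regular (r i) (G i)) →
    (∀ i → gcd (n i) (∏-except i r) ≡ 1) →
    (∀ i → ℤ[ n i ]-DistanceAntimagic (G i)) →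
    ℤ[ ∏ n ]-DistanceAntimagic (directProduct G)
mainTheorem14 G n r _ reg gcd≡1 am =
  Antimagic⇒DistanceAntimagic (directProduct G)
    (antimagic-cong (tupleN≗filter G) (tupleN-antimagic G n r reg n⊥r am))
  where
  n⊥r : ∀ i j → i ≢ j → Coprime (n i) (r j)
  -- A common divisor of `n i` and `r j` also divides `∏-except i r`, hence is 1.
  n⊥r i j i≢j (d∣n , d∣r) = gcd≡1⇒coprime (gcd≡1 i) (d∣n , ∣-trans d∣r (∣∏-except r i≢j))
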